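{- For any dotted composition $\alpha=(\alpha_1,\dots,\alpha_l)$, the coproduct of ${\rm sQSym}$ satisfies $$\Delta(M_\alpha)=\sum_{\beta\cdot\gamma=\alpha}M_\beta\otimes M_\gamma=\sum_{k=0}^{l}M_{\alpha_1,\dots,\alpha_k}\otimes M_{\alpha_{k+1},\dots,\alpha_l},$$ where $\beta\cdot\gamma$ denotes concatenation of dotted compositions.
   Context: Variables $x_1,x_2,\dots$ commute; $\theta_1,\theta_2,\dots$ anticommute ($\theta_i\theta_j=-\theta_j\theta_i$, $\theta_i^2=0$). A dotted composition $\alpha=(\alpha_1,\dots,\alpha_l)$ is a finite (possibly empty) sequence whose entries belong to $\{1,2,3,\dots\}$ (non-dotted) or $\{\dot0,\dot1,\dot2,\dots\}$ (dotted). Put $\eta_i=1$ if $\alpha_i$ is dotted and $\eta_i=0$ otherwise. ${\rm sQSym}$ is the $\mathbb Q$-vector space of formal power series $f$ of bounded degree in these variables such that, for every dotted composition $\alpha$, all monomials $\theta_{i_1}^{\eta_1}\cdots\theta_{i_l}^{\eta_l}x_{i_1}^{\alpha_1}\cdots x_{i_l}^{\alpha_l}$ with $i_1<\cdots<i_l$ have the same coefficient in $f$ (dots are ignored in exponents of the $x$'s). It has the basis $M_\alpha=\sum_{i_1<\cdots<i_l}\theta_{i_1}^{\eta_1}\cdots\theta_{i_l}^{\eta_l}x_{i_1}^{\alpha_1}\cdots x_{i_l}^{\alpha_l}$, with $M_\emptyset=1$. ${\rm sQSym}\otimes{\rm sQSym}$ (over $\mathbb Q$) is identified with functions, quasisymmetric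 in each set, of two sets of variables $(x;\theta)$ and $(y;\phi)$, linearly ordered by $x_1<x_2<\cdots<y_1<y_2<\cdots$ and $\theta_1<\theta_2<\cdots<\phi_1<\phi_2<\cdots$, with the $\theta$'s and $\phi$'s anticommuting with each other; $f\otimes g$ corresponds to $f(x;\theta)g(y;\phi)$. The coproduct is $(\Delta f)(x,y;\theta,\phi)=f(x,y;\theta,\phi)$, i.e. $f$ evaluated on the ordered union of the two sets of variables. -}

module Defs where

open import Data.Bool using (if_then_else_)
open import Data.List using (List; []; _∷_; _++_; map; null; foldr; upTo; cartesianProductWith)
open import Data.List.Membership.Propositional using (_∈_)
open import Data.List.Membership.Propositional.Properties using (∈-map⁺; ∈-map⁻)
open import Data.List.Properties using (≡-dec)
open import Data.List.Relation.Unary.All using (All; []; _∷_)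
open import Data.List.Relation.Unary.AllPairs using (AllPairs; []; _∷_)
open import Data.List.Relation.Unary.Any using (here; there)
open import Data.List.Relation.Unary.Unique.Propositional using (Unique)
import Data.List.Relation.Unary.Unique.Propositional.Properties as Unique
open import Data.Maybe using (Maybe; just; nothing)
open import Data.Nat as ℕ using (ℕ; zero; suc; _∸_; _<_; NonZero)
open import Data.Nat.ListAction using (sum)
import Data.Nat.Properties as ℕ
open import Data.Product using (_×_; _,_; proj₁; proj₂; ∃-syntax)
open import Data.Rational as ℚ using (ℚ; 0ℚ; 1ℚ)
open import Data.Sum using (_⊎_; inj₁; inj₂)
open import Data.Sum.Relation.Binary.LeftOrder using (_⊎-<_; drop-inj₁; drop-inj₂)
open import Function using (_on_; _∘_)
open import Level using (0ℓ)
open import Relation.Binary using (Rel; DecidableEquality)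
open import Relation.Binary.PropositionalEquality using (_≡_; _≢_; refl; sym; trans; cong)
open import Relation.Nullary using (yes; no; does; contradiction)
open import Relation.Nullary.Decidable using (map′)

data Part : Set where
  undotted : (n : ℕ) .⦃ _ : NonZero n ⦄ → Part
  dotted   : (n : ℕ) → Part

DottedComposition : Set
DottedComposition = List Part

size : Part → ℕ
size (undotted n) = n
size (dotted n)   = n

η : Part → ℕ
η (undotted _) = 0
η (dotted _)   = 1

undotted-cong : ∀ {m n} .⦃ _ : NonZero m ⦄ .⦃ _ : NonZero n ⦄ → m ≡ n → undotted m ≡ undotted n
undotted-cong refl = refl

_≟ᴾ_ : DecidableEquality Part
undotted m ≟ᴾ undotted n = map′ undotted-cong (cong size) (m ℕ.≟ n)
undotted _ ≟ᴾ dotted _   = no λ ()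
dotted _   ≟ᴾ undotted _ = no λ ()
dotted m   ≟ᴾ dotted n   = map′ (cong dotted) (cong size) (m ℕ.≟ n)

_≟_ : DecidableEquality DottedComposition
_≟_ = ≡-dec _≟ᴾ_

-- Monomials in commuting x_i and anticommuting θ_i, i ranging over a
-- strictly totally ordered index set I.
--
-- A monomial is kept in the normal form
--   θ_{i₁}^{η₁} ⋯ θ_{iₗ}^{ηₗ} x_{i₁}^{α₁} ⋯ x_{iₗ}^{αₗ},   i₁ < ⋯ < iₗ,
-- where the indices listed are exactly those of the variables that occur.
-- The pair (α_j , η_j) ≠ (0 , 0) is then precisely a part: x_i^n is
-- (i , undotted n) and θ_i x_i^n is (i , dotted n).

Word : Set → Set
Word I = List (I × Part)

Increasing : {I : Set} → Rel I 0ℓ → Word I → Set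
Increasing _≺_ = AllPairs (_≺_ on proj₁)

record Monomial {I : Set} (_≺_ : Rel I 0ℓ) : Set where
  constructor mono
  field
    word        : Word I
    .increasing : Increasing _≺_ word

open Monomial public

module _ {I : Set} {_≺_ : Rel I 0ℓ} where

  shape : Monomial _≺_ → DottedComposition
  shape m = map proj₂ (word m)

  -- Every x_i and every θ_i counts 1.
  degree : Monomial _≺_ → ℕ
  degree m = sum (map (λ a → size a ℕ.+ η a) (shape m))

-- A formal power series over ℚ is given by its coefficients.
Series : {I : Set} → Rel I 0ℓ → Set
Series _≺_ = Monomial _≺_ → ℚ

module _ {I : Set} {_≺_ : Rel I 0ℓ} where

  infix 4 _≈_
  _≈_ : Rel (Series _≺_) 0ℓ
  f ≈ g = ∀ m → f m ≡ g m

  0ˢ : Series _≺_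
  0ˢ _ = 0ℚ

  infixl 6 _+ˢ_
  _+ˢ_ : Series _≺_ → Series _≺_ → Series _≺_
  (f +ˢ g) m = f m ℚ.+ g m

  ∑ : {A : Set} → List A → (A → Series _≺_) → Series _≺_
  ∑ as f = foldr (λ a s → f a +ˢ s) 0ˢ as

-- Multiplication.  The coefficient of m in f g collects all ways of
-- writing m = ± u v with monomials u, v.  Such a factorisation is chosen
-- separately at each index i: the factor θ_i^η x_i^n of m is distributed
-- over u and v, where `nothing` stands for the trivial factor 1.

x^ : ℕ → Maybe Part
x^ zero    = nothing
x^ (suc n) = just (undotted (suc n))

Split : Set
Split = Maybe Part × Maybe Part

splits : Part → List Split
splits (undotted n) = map (λ k → x^ k , x^ (n ∸ k)) (upTo (suc n))
splits (dotted n)   = map (λ k → just (dotted k) , x^ (n ∸ k)) (upTo (suc n))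
                   ++ map (λ k → x^ k , just (dotted (n ∸ k))) (upTo (suc n))

-- One Split for each index occurring in the word.
Factorisation : {I : Set} → Word I → Set
Factorisation w = All (λ _ → Split) w

module _ {I : Set} where

  factorisations : (w : Word I) → List (Factorisation w)
  factorisations []            = [] ∷ []
  factorisations ((_ , a) ∷ w) = cartesianProductWith _∷_ (splits a) (factorisations w)

  select : (Split → Maybe Part) → {w : Word I} → Factorisation w → Word I
  select π {[]}          []      = []
  select π {(i , _) ∷ _} (s ∷ F) with π s
  ... | nothing = select π F
  ... | just b  = (i , b) ∷ select π F

  θ-degree : Word I → ℕ
  θ-degree w = sum (map (η ∘ proj₂) w)

  ηᴹ : Maybe Part → ℕ
  ηᴹ nothing  = 0
  ηᴹ (just a) = η a

  -- The number of pairs i < j with θ_i in v and θ_j in u, i.e. the number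
  -- of transpositions bringing the θ's of u v into increasing order.
  inversions : {w : Word I} → Factorisation w → ℕ
  inversions []            = 0
  inversions ((_ , c) ∷ F) = ηᴹ c ℕ.* θ-degree (select proj₁ F) ℕ.+ inversions F

  module _ {_≺_ : Rel I 0ℓ} where

    select-All : ∀ (i : I) π {w : Word I} (F : Factorisation w) →
                 All (λ p → i ≺ proj₁ p) w → All (λ p → i ≺ proj₁ p) (select π F)
    select-All i π []      []       = []
    select-All i π (s ∷ F) (p ∷ ps) with π s
    ... | nothing = select-All i π F ps
    ... | just _  = p ∷ select-All i π F ps

    select-increasing : ∀ π {w : Word I} (F : Factorisation w) →
                        Increasing _≺_ w → Increasing _≺_ (select π F)
    select-increasing π []      []       = []
    select-increasing π (s ∷ F) (p ∷ ps) with π s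
    ... | nothing = select-increasing π F ps
    ... | just _  = select-All _ π F p ∷ select-increasing π F ps

    factor : (Split → Maybe Part) → (m : Monomial _≺_) → Factorisation (word m) → Monomial _≺_
    factor π (mono _ inc) F = mono (select π F) (select-increasing π F inc)

-1^_ : ℕ → ℚ
-1^ zero  = 1ℚ
-1^ suc n = ℚ.- (-1^ n)

sumℚ : List ℚ → ℚ
sumℚ = foldr ℚ._+_ 0ℚ

infixl 7 _*ˢ_
_*ˢ_ : {I : Set} {_≺_ : Rel I 0ℓ} → Series _≺_ → Series _≺_ → Series _≺_
(f *ˢ g) m = sumℚ (map (λ F → (-1^ inversions F) ℚ.* (f (factor proj₁ m F) ℚ.* g (factor proj₂ m F)))
                       (factorisations (word m)))

-- The variables are indexed from 0: (x₀ , x₁ , …; θ₀ , θ₁ , …).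
QuasiSymmetric : Series _<_ → Set
QuasiSymmetric f = ∀ α m m′ → shape m ≡ α → shape m′ ≡ α → f m ≡ f m′

BoundedDegree : Series _<_ → Set
BoundedDegree f = ∃[ d ] (∀ m → d < degree m → f m ≡ 0ℚ)

record SQSym : Set where
  field
    series         : Series _<_
    boundedDegree  : BoundedDegree series
    quasiSymmetric : QuasiSymmetric series

open SQSym public

-- The coefficient of θ_{i₁}^{η₁} ⋯ x_{i₁}^{β₁} ⋯ in
-- ∑_{i₁<⋯<iₗ} θ_{i₁}^{η₁} ⋯ θ_{iₗ}^{ηₗ} x_{i₁}^{α₁} ⋯ x_{iₗ}^{αₗ}:
-- each monomial of shape α is obtained for exactly one choice of indices.
M-series : DottedComposition → Series _<_
M-series α m = if does (shape m ≟ α) then 1ℚ else 0ℚ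

M : DottedComposition → SQSym
M α = record
  { series         = M-series α
  ; boundedDegree  = sum (map (λ a → size a ℕ.+ η a) α) , bounded
  ; quasiSymmetric = λ β m m′ p p′ →
      cong (λ γ → if does (γ ≟ α) then 1ℚ else 0ℚ) (trans p (sym p′))
  }
  where
  bounded : ∀ m → sum (map (λ a → size a ℕ.+ η a) α) < degree m → M-series α m ≡ 0ℚ
  bounded m lt with shape m ≟ α
  ... | yes refl = contradiction lt (ℕ.<-irrefl refl)
  ... | no _     = refl

-- Two sets of variables: inj₁ i indexes x_i, θ_i and inj₂ i indexes
-- y_i, φ_i, with all of the first set preceding all of the second.
_<₂_ : Rel (ℕ ⊎ ℕ) 0ℓ
_<₂_ = _<_ ⊎-< _<_

xθ-word : Word (ℕ ⊎ ℕ) → Word ℕ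
xθ-word []                 = []
xθ-word ((inj₁ i , a) ∷ w) = (i , a) ∷ xθ-word w
xθ-word ((inj₂ _ , _) ∷ w) = xθ-word w

yφ-word : Word (ℕ ⊎ ℕ) → Word ℕ
yφ-word []                 = []
yφ-word ((inj₁ _ , _) ∷ w) = yφ-word w
yφ-word ((inj₂ i , a) ∷ w) = (i , a) ∷ yφ-word w

xθ-All : ∀ i w → All (λ p → inj₁ i <₂ proj₁ p) w → All (λ p → i < proj₁ p) (xθ-word w)
xθ-All i []                 []       = []
xθ-All i ((inj₁ _ , _) ∷ w) (p ∷ ps) = drop-inj₁ p ∷ xθ-All i w ps
xθ-All i ((inj₂ _ , _) ∷ w) (_ ∷ ps) = xθ-All i w ps

yφ-All : ∀ i w → All (λ p → inj₂ i <₂ proj₁ p) w → All (λ p → i < proj₁ p) (yφ-word w)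
yφ-All i []                 []       = []
yφ-All i ((inj₁ _ , _) ∷ w) (_ ∷ ps) = yφ-All i w ps
yφ-All i ((inj₂ _ , _) ∷ w) (p ∷ ps) = drop-inj₂ p ∷ yφ-All i w ps

xθ-increasing : ∀ w → Increasing _<₂_ w → Increasing _<_ (xθ-word w)
xθ-increasing []                 []       = []
xθ-increasing ((inj₁ i , _) ∷ w) (p ∷ ps) = xθ-All i w p ∷ xθ-increasing w ps
xθ-increasing ((inj₂ _ , _) ∷ w) (_ ∷ ps) = xθ-increasing w ps

yφ-increasing : ∀ w → Increasing _<₂_ w → Increasing _<_ (yφ-word w)
yφ-increasing []                 []       = []
yφ-increasing ((inj₁ _ , _) ∷ w) (_ ∷ ps) = yφ-increasing w ps
yφ-increasing ((inj₂ i , _) ∷ w) (p ∷ ps) = yφ-All i w p ∷ yφ-increasing w ps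

xθ-part : Monomial _<₂_ → Monomial _<_
xθ-part (mono w inc) = mono (xθ-word w) (xθ-increasing w inc)

yφ-part : Monomial _<₂_ → Monomial _<_
yφ-part (mono w inc) = mono (yφ-word w) (yφ-increasing w inc)

-- f(x;θ) and g(y;φ), regarded as series in all the variables.
_[x,θ] : Series _<_ → Series _<₂_
(f [x,θ]) m = if null (word (yφ-part m)) then f (xθ-part m) else 0ℚ

_[y,φ] : Series _<_ → Series _<₂_
(g [y,φ]) m = if null (word (xθ-part m)) then g (yφ-part m) else 0ℚ

-- The element of sQSym ⊗ sQSym represented by f(x;θ) g(y;φ).
infixl 7 _⊗_
_⊗_ : SQSym → SQSym → Series _<₂_
f ⊗ g = (series f [x,θ]) *ˢ (series g [y,φ])

number : ℕ → DottedComposition → Word ℕ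
number k []      = []
number k (a ∷ α) = (k , a) ∷ number (suc k) α

number-All : ∀ {j} k α → j < k → All (λ p → j < proj₁ p) (number k α)
number-All k []      j<k = []
number-All k (a ∷ α) j<k = j<k ∷ number-All (suc k) α (ℕ.m<n⇒m<1+n j<k)

number-increasing : ∀ k α → Increasing _<_ (number k α)
number-increasing k []      = []
number-increasing k (a ∷ α) = number-All (suc k) α (ℕ.n<1+n k) ∷ number-increasing (suc k) α

packed : DottedComposition → Monomial _<_
packed α = mono (number 0 α) (number-increasing 0 α)

-- f evaluated on any linearly ordered set of variables: the coefficient
-- of a monomial of shape α is the common coefficient in f of all
-- monomials of shape α (evaluate-coefficient), read off at the one in the
-- first variables.
evaluate : {I : Set} (_≺_ : Rel I 0ℓ) → SQSym → Series _≺_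
evaluate _≺_ f m = series f (packed (shape m))

shape-packed : ∀ k α → map proj₂ (number k α) ≡ α
shape-packed k []      = refl
shape-packed k (a ∷ α) = cong (a ∷_) (shape-packed (suc k) α)

evaluate-coefficient : ∀ {I : Set} {_≺_ : Rel I 0ℓ} (f : SQSym) (m : Monomial _≺_) (m′ : Monomial _<_) →
                       shape m′ ≡ shape m → evaluate _≺_ f m ≡ series f m′
evaluate-coefficient f m m′ p =
  quasiSymmetric f (shape m) (packed (shape m)) m′ (shape-packed 0 (shape m)) p

evaluate-self : ∀ f → evaluate _<_ f ≈ series f
evaluate-self f m = evaluate-coefficient f m m refl

Δ : SQSym → Series _<₂_
Δ = evaluate _<₂_

record Enumeration {A : Set} (P : A → Set) : Set where
  field
    elements : List A
    unique   : Unique elements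
    sound    : ∀ {a} → a ∈ elements → P a
    complete : ∀ {a} → P a → a ∈ elements

open Enumeration public

Decomposes : DottedComposition → DottedComposition × DottedComposition → Set
Decomposes α (β , γ) = β ++ γ ≡ α

prepend : Part → DottedComposition × DottedComposition → DottedComposition × DottedComposition
prepend a (β , γ) = a ∷ β , γ

decompositionList : DottedComposition → List (DottedComposition × DottedComposition)
decompositionList []      = ([] , []) ∷ []
decompositionList (a ∷ α) = ([] , a ∷ α) ∷ map (prepend a) (decompositionList α)

decompositionList-sound : ∀ α {p} → p ∈ decompositionList α → Decomposes α p
decompositionList-sound []      (here refl) = refl
decompositionList-sound (a ∷ α) (here refl) = refl
decompositionList-sound (a ∷ α) (there p∈)  with ∈-map⁻ (prepend a) p∈
... | _ , q∈ , refl = cong (a ∷_) (decompositionList-sound α q∈)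

decompositionList-complete : ∀ α {p} → Decomposes α p → p ∈ decompositionList α
decompositionList-complete []      {[]    , []} refl = here refl
decompositionList-complete (a ∷ α) {[]    , γ}  refl = here refl
decompositionList-complete (a ∷ α) {b ∷ β , γ}  refl =
  there (∈-map⁺ (prepend a) (decompositionList-complete α {β , γ} refl))

prepend-injective : ∀ {a p q} → prepend a p ≡ prepend a q → p ≡ q
prepend-injective refl = refl

[]-fresh : ∀ a α ps → All (([] , α) ≢_) (map (prepend a) ps)
[]-fresh a α []       = []
[]-fresh a α (_ ∷ ps) = (λ ()) ∷ []-fresh a α ps

decompositionList-unique : ∀ α → Unique (decompositionList α)
decompositionList-unique []      = [] ∷ []
decompositionList-unique (a ∷ α) =
  []-fresh a (a ∷ α) (decompositionList α) ∷ Unique.map⁺ prepend-injective (decompositionList-unique α)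

decompositions : ∀ α → Enumeration (Decomposes α)
decompositions α = record
  { elements = decompositionList α
  ; unique   = decompositionList-unique α
  ; sound    = decompositionList-sound α
  ; complete = decompositionList-complete α
  }

∑-over : {A : Set} {P : A → Set} {I : Set} {_≺_ : Rel I 0ℓ} →
         Enumeration P → (A → Series _≺_) → Series _≺_
∑-over E f = ∑ (elements E) f

{-# OPTIONS --safe #-}
module Submission where

-- In the product f(x;θ) g(y;φ), a factorisation m = ± u v contributes only if
-- u involves only x, θ and v only y, φ.  There is exactly one such factorisation,
-- and since all of the first variables precede all of the second, its sign is +1.
-- So M_β ⊗ M_γ has coefficient 1 at m if β and γ are the shapes of the two halves
-- of m, and 0 otherwise; as the shape of m is the concatenation of these
-- two shapes, summing over β · γ = α gives the coefficient of Δ M_α.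

open import Defs
open import Data.Bool using (true; false; if_then_else_)
open import Data.List using (List; []; _∷_; _++_; map; length; take; drop; null; upTo; applyUpTo; cartesianProductWith)
open import Data.List.Properties using (map-∘; map-cong; map-applyUpTo; map-upTo; foldr-map)
open import Data.List.Relation.Unary.All using (All; []; _∷_)
open import Data.List.Relation.Unary.AllPairs using ([]; _∷_)
open import Data.Maybe using (Maybe; just; nothing)
open import Data.Nat as ℕ using (ℕ; zero; suc; _∸_; _<_; z<s; s<s)
import Data.Nat.Properties as ℕ
open import Data.Product using (_×_; _,_; proj₁; proj₂)
open import Data.Rational as ℚ using (ℚ; 0ℚ; 1ℚ)
import Data.Rational.Properties as ℚ
open import Data.Sum using (_⊎_; inj₁; inj₂)
open import Data.Sum.Relation.Binary.LeftOrder using (₂∼₂)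
open import Function using (_∘_; _$_)
open import Relation.Binary.PropositionalEquality using (_≡_; _≗_; refl; sym; trans; cong; cong₂; module ≡-Reasoning)
open import Relation.Nullary using (does)
open import Relation.Nullary.Decidable using (recompute)

open ≡-Reasoning

-- Finite sums of rationals.

module _ {A : Set} where

  sumℚ-++ : (f : A → ℚ) (xs ys : List A) →
            sumℚ (map f (xs ++ ys)) ≡ sumℚ (map f xs) ℚ.+ sumℚ (map f ys)
  sumℚ-++ f []       ys = sym (ℚ.+-identityˡ _)
  sumℚ-++ f (x ∷ xs) ys = trans (cong (f x ℚ.+_) (sumℚ-++ f xs ys)) (sym (ℚ.+-assoc (f x) _ _))

  sumℚ-cong : {f g : A → ℚ} → f ≗ g → ∀ xs → sumℚ (map f xs) ≡ sumℚ (map g xs)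
  sumℚ-cong f≗g xs = cong sumℚ (map-cong f≗g xs)

  sumℚ-zero : {f : A → ℚ} → (∀ x → f x ≡ 0ℚ) → ∀ xs → sumℚ (map f xs) ≡ 0ℚ
  sumℚ-zero f≡0 []       = refl
  sumℚ-zero f≡0 (x ∷ xs) = cong₂ ℚ._+_ (f≡0 x) (sumℚ-zero f≡0 xs)

  ∑-coefficient : ∀ {I : Set} {_≺_ : I → I → Set} (as : List A) (f : A → Series _≺_) m →
                  ∑ as f m ≡ sumℚ (map (λ a → f a m) as)
  ∑-coefficient []       f m = refl
  ∑-coefficient (a ∷ as) f m = cong (f a m ℚ.+_) (∑-coefficient as f m)

sumℚ-map-zero : {A B : Set} (h : B → ℚ) (g : A → B) (xs : List A) →
                (∀ x → h (g x) ≡ 0ℚ) → sumℚ (map h (map g xs)) ≡ 0ℚ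
sumℚ-map-zero h g xs h∘g≡0 = trans (cong sumℚ (sym (map-∘ xs))) (sumℚ-zero h∘g≡0 xs)

sumℚ-cartesianProductWith :
  {A B C : Set} (t : C → ℚ) (f : A → B → C) (xs : List A) (ys : List B) →
  sumℚ (map t (cartesianProductWith f xs ys)) ≡ sumℚ (map (λ x → sumℚ (map (t ∘ f x) ys)) xs)
sumℚ-cartesianProductWith t f []       ys = refl
sumℚ-cartesianProductWith t f (x ∷ xs) ys = begin
  sumℚ (map t (map (f x) ys ++ cartesianProductWith f xs ys))
    ≡⟨ sumℚ-++ t (map (f x) ys) _ ⟩
  sumℚ (map t (map (f x) ys)) ℚ.+ sumℚ (map t (cartesianProductWith f xs ys))
    ≡⟨ cong₂ ℚ._+_ (cong sumℚ (sym (map-∘ ys))) (sumℚ-cartesianProductWith t f xs ys) ⟩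
  sumℚ (map (t ∘ f x) ys) ℚ.+ sumℚ (map (λ x → sumℚ (map (t ∘ f x) ys)) xs) ∎

sumℚ-applyUpTo-zero : ∀ (t : ℕ → ℚ) n → (∀ k → t k ≡ 0ℚ) → sumℚ (applyUpTo t n) ≡ 0ℚ
sumℚ-applyUpTo-zero t zero    t≡0 = refl
sumℚ-applyUpTo-zero t (suc n) t≡0 = cong₂ ℚ._+_ (t≡0 0) (sumℚ-applyUpTo-zero (t ∘ suc) n (t≡0 ∘ suc))

sumℚ-applyUpTo-first : ∀ (t : ℕ → ℚ) n → (∀ k → t (suc k) ≡ 0ℚ) → sumℚ (applyUpTo t (suc n)) ≡ t 0
sumℚ-applyUpTo-first t n t≡0 =
  trans (cong (t 0 ℚ.+_) (sumℚ-applyUpTo-zero (t ∘ suc) n t≡0)) (ℚ.+-identityʳ (t 0))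

sumℚ-applyUpTo-last : ∀ (t : ℕ → ℚ) n → (∀ k → k < n → t k ≡ 0ℚ) → sumℚ (applyUpTo t (suc n)) ≡ t n
sumℚ-applyUpTo-last t zero    t≡0 = ℚ.+-identityʳ (t 0)
sumℚ-applyUpTo-last t (suc n) t≡0 = begin
  t 0 ℚ.+ sumℚ (applyUpTo (t ∘ suc) (suc n))
    ≡⟨ cong₂ ℚ._+_ (t≡0 0 z<s) (sumℚ-applyUpTo-last (t ∘ suc) n (λ k → t≡0 (suc k) ∘ s<s)) ⟩
  0ℚ ℚ.+ t (suc n)
    ≡⟨ ℚ.+-identityˡ _ ⟩
  t (suc n) ∎

map-map-upTo : {A : Set} (h : A → ℚ) (g : ℕ → A) (n : ℕ) →
               map h (map g (upTo n)) ≡ applyUpTo (h ∘ g) n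
map-map-upTo h g n = trans (sym (map-∘ (upTo n))) (map-upTo (h ∘ g) n)

-- Sums over the splits of a single part.

module _ (h : Split → ℚ) where

  module _ (h≡0 : ∀ b c → h (b , just c) ≡ 0ℚ) where

    private
      last : ∀ (u : ℕ → Maybe Part) n →
             sumℚ (map h (map (λ k → u k , x^ (n ∸ k)) (upTo (suc n)))) ≡ h (u n , nothing)
      last u n = begin
        sumℚ (map h (map (λ k → u k , x^ (n ∸ k)) (upTo (suc n))))
          ≡⟨ cong sumℚ (map-map-upTo h _ (suc n)) ⟩
        sumℚ (applyUpTo (λ k → h (u k , x^ (n ∸ k))) (suc n))
          ≡⟨ sumℚ-applyUpTo-last _ n vanish ⟩
        h (u n , x^ (n ∸ n))
          ≡⟨ cong (λ j → h (u n , x^ j)) (ℕ.n∸n≡0 n) ⟩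
        h (u n , nothing) ∎
        where
        vanish : ∀ k → k < n → h (u k , x^ (n ∸ k)) ≡ 0ℚ
        -- Positivity of `n ∸ k` excludes `zero`, so the second component computes to a `just`.
        vanish k k<n with n ∸ k | ℕ.m<n⇒0<n∸m k<n
        ... | suc j | _ = h≡0 (u k) (undotted (suc j))

    -- This serves an index of x, θ, where the right factor must be trivial. The complementary power
    -- `x^ (n ∸ k)` is trivial only at `k = n`, and the second list for a dotted part always sends θ
    -- to the right.
    sumℚ-splits-left : ∀ a → sumℚ (map h (splits a)) ≡ h (just a , nothing)
    sumℚ-splits-left (undotted (suc n)) = last x^ (suc n)
    sumℚ-splits-left (dotted n)         = begin
      sumℚ (map h (splits (dotted n)))
        ≡⟨ sumℚ-++ h (map (λ k → just (dotted k) , x^ (n ∸ k)) (upTo (suc n))) _ ⟩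
      sumℚ (map h (map (λ k → just (dotted k) , x^ (n ∸ k)) (upTo (suc n))))
        ℚ.+ sumℚ (map h (map (λ k → x^ k , just (dotted (n ∸ k))) (upTo (suc n))))
        ≡⟨ cong₂ ℚ._+_ (last (just ∘ dotted) n)
             (sumℚ-map-zero h _ (upTo (suc n)) (λ k → h≡0 (x^ k) (dotted (n ∸ k)))) ⟩
      h (just (dotted n) , nothing) ℚ.+ 0ℚ
        ≡⟨ ℚ.+-identityʳ _ ⟩
      h (just (dotted n) , nothing) ∎

  module _ (h≡0 : ∀ b c → h (just b , c) ≡ 0ℚ) where

    private
      first : ∀ (v : ℕ → Maybe Part) n →
              sumℚ (map h (map (λ k → x^ k , v k) (upTo (suc n)))) ≡ h (nothing , v 0)
      first v n = trans (cong sumℚ (map-map-upTo h _ (suc n)))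
                        (sumℚ-applyUpTo-first (λ k → h (x^ k , v k)) n (λ k → h≡0 _ (v (suc k))))

    -- The mirror case, for an index of y, φ: `x^ k` is trivial only at `k = 0`, and the first list
    -- for a dotted part always sends θ to the left.
    sumℚ-splits-right : ∀ a → sumℚ (map h (splits a)) ≡ h (nothing , just a)
    sumℚ-splits-right (undotted (suc n)) = first (λ k → x^ (suc n ∸ k)) (suc n)
    sumℚ-splits-right (dotted n)         = begin
      sumℚ (map h (splits (dotted n)))
        ≡⟨ sumℚ-++ h (map (λ k → just (dotted k) , x^ (n ∸ k)) (upTo (suc n))) _ ⟩
      sumℚ (map h (map (λ k → just (dotted k) , x^ (n ∸ k)) (upTo (suc n))))
        ℚ.+ sumℚ (map h (map (λ k → x^ k , just (dotted (n ∸ k))) (upTo (suc n))))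
        ≡⟨ cong₂ ℚ._+_
             (sumℚ-map-zero h _ (upTo (suc n)) (λ k → h≡0 (dotted k) (x^ (n ∸ k))))
             (first (λ k → just (dotted (n ∸ k))) n) ⟩
      0ℚ ℚ.+ h (nothing , just (dotted n))
        ≡⟨ ℚ.+-identityˡ _ ⟩
      h (nothing , just (dotted n)) ∎

-- The product of a series in x, θ with a series in y, φ.

-- Coefficient functions are taken on bare words, so that they can be
-- precomposed with (i , a) ∷_ without an ordering condition.
onlyX onlyY : (Word ℕ → ℚ) → Word (ℕ ⊎ ℕ) → ℚ
onlyX p w = if null (yφ-word w) then p (xθ-word w) else 0ℚ
onlyY q w = if null (xθ-word w) then q (yφ-word w) else 0ℚ

term : (p q : Word ℕ → ℚ) {w : Word (ℕ ⊎ ℕ)} → Factorisation w → ℚ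
term p q F = (-1^ inversions F) ℚ.* (onlyX p (select proj₁ F) ℚ.* onlyY q (select proj₂ F))

productCoefficient : (p q : Word ℕ → ℚ) → Word (ℕ ⊎ ℕ) → ℚ
productCoefficient p q w = sumℚ (map (term p q) (factorisations w))

*-zeroˡ-middle : ∀ s y → s ℚ.* (0ℚ ℚ.* y) ≡ 0ℚ
*-zeroˡ-middle s y = trans (cong (s ℚ.*_) (ℚ.*-zeroˡ y)) (ℚ.*-zeroʳ s)

*-zeroʳ-middle : ∀ s x → s ℚ.* (x ℚ.* 0ℚ) ≡ 0ℚ
*-zeroʳ-middle s x = trans (cong (s ℚ.*_) (ℚ.*-zeroʳ x)) (ℚ.*-zeroʳ s)

module _ (p q : Word ℕ → ℚ) (i : ℕ) where

  -- The right factor keeps a letter at `inj₁ i`, so the emptiness test in `onlyY` fails by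
  -- computation.
  term-x-vanishes : ∀ {a w} b c (F : Factorisation w) →
                    term p q {(inj₁ i , a) ∷ w} ((b , just c) ∷ F) ≡ 0ℚ
  term-x-vanishes {a} {w} b c F =
    *-zeroʳ-middle (-1^ inversions {w = (inj₁ i , a) ∷ w} ((b , just c) ∷ F))
                   (onlyX p (select proj₁ {(inj₁ i , a) ∷ w} ((b , just c) ∷ F)))

  term-y-vanishes : ∀ {a w} b c (F : Factorisation w) →
                    term p q {(inj₂ i , a) ∷ w} ((just b , c) ∷ F) ≡ 0ℚ
  term-y-vanishes {a} {w} b c F =
    *-zeroˡ-middle (-1^ inversions {w = (inj₂ i , a) ∷ w} ((just b , c) ∷ F))
                   (onlyY q (select proj₂ {(inj₂ i , a) ∷ w} ((just b , c) ∷ F)))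

  -- Either no θ remains to be moved past, or a later y or φ lies in the
  -- left factor and both sides vanish.
  term-y : ∀ {a w} (F : Factorisation w) → All (λ l → inj₂ i <₂ proj₁ l) w →
           term p q {(inj₂ i , a) ∷ w} ((nothing , just a) ∷ F) ≡ term p (q ∘ ((i , a) ∷_)) F
  -- The bound `i<w` passes to the left factor, so its first letter, if any, cannot be an `inj₁`.
  term-y {a} F i<w with select proj₁ F | select-All {_≺_ = _<₂_} (inj₂ i) proj₁ F i<w
  ... | []              | _            =
    cong (λ d → (-1^ (d ℕ.+ inversions F)) ℚ.* (p [] ℚ.* Y)) (ℕ.*-zeroʳ (η a))
    where Y = onlyY (q ∘ ((i , a) ∷_)) (select proj₂ F)
  ... | (inj₂ j , b) ∷ v | ₂∼₂ _ ∷ _ =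
    trans (*-zeroˡ-middle (-1^ (η a ℕ.* θ-degree ((inj₂ j , b) ∷ v) ℕ.+ inversions F)) Y)
          (sym (*-zeroˡ-middle (-1^ inversions F) Y))
    where Y = onlyY (q ∘ ((i , a) ∷_)) (select proj₂ F)

yφ⇒xθ-empty : ∀ {i} w → All (λ l → inj₂ i <₂ proj₁ l) w → xθ-word w ≡ []
yφ⇒xθ-empty []                 []            = refl
yφ⇒xθ-empty ((inj₂ _ , _) ∷ w) (₂∼₂ _ ∷ i<w) = yφ⇒xθ-empty w i<w

-- Induction on the word. The one surviving split gives the whole first letter to one factor, and
-- the letter is then absorbed into `p` or `q`; hence both stay general in the induction.
productCoefficient-increasing : ∀ p q w → Increasing _<₂_ w →
                                productCoefficient p q w ≡ p (xθ-word w) ℚ.* q (yφ-word w)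
productCoefficient-increasing p q [] [] =
  trans (ℚ.+-identityʳ _) (ℚ.*-identityˡ _)
productCoefficient-increasing p q ((inj₁ i , a) ∷ w) (_ ∷ inc) = begin
  productCoefficient p q ((inj₁ i , a) ∷ w)
    ≡⟨ sumℚ-cartesianProductWith (term p q {(inj₁ i , a) ∷ w}) _∷_ (splits a) (factorisations w) ⟩
  sumℚ (map splitSum (splits a))
    -- The surviving terms already have the required form: the right factor gets nothing at this
    -- index, so the number of inversions reduces to that of `F`.
    ≡⟨ sumℚ-splits-left splitSum (λ b c → sumℚ-zero (term-x-vanishes p q i {a} b c) (factorisations w)) a ⟩
  productCoefficient (p ∘ ((i , a) ∷_)) q w
    ≡⟨ productCoefficient-increasing (p ∘ ((i , a) ∷_)) q w inc ⟩
  p ((i , a) ∷ xθ-word w) ℚ.* q (yφ-word w) ∎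
  where
  splitSum : Split → ℚ
  splitSum s = sumℚ (map (λ F → term p q {(inj₁ i , a) ∷ w} (s ∷ F)) (factorisations w))
productCoefficient-increasing p q ((inj₂ i , a) ∷ w) (i<w ∷ inc) = begin
  productCoefficient p q ((inj₂ i , a) ∷ w)
    ≡⟨ sumℚ-cartesianProductWith (term p q {(inj₂ i , a) ∷ w}) _∷_ (splits a) (factorisations w) ⟩
  sumℚ (map splitSum (splits a))
    ≡⟨ sumℚ-splits-right splitSum (λ b c → sumℚ-zero (term-y-vanishes p q i {a} b c) (factorisations w)) a ⟩
  sumℚ (map (λ F → term p q {(inj₂ i , a) ∷ w} ((nothing , just a) ∷ F)) (factorisations w))
    ≡⟨ sumℚ-cong (λ F → term-y p q i F i<w) (factorisations w) ⟩
  productCoefficient p (q ∘ ((i , a) ∷_)) w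
    ≡⟨ productCoefficient-increasing p (q ∘ ((i , a) ∷_)) w inc ⟩
  p (xθ-word w) ℚ.* q ((i , a) ∷ yφ-word w) ∎
  where
  splitSum : Split → ℚ
  splitSum s = sumℚ (map (λ F → term p q {(inj₂ i , a) ∷ w} (s ∷ F)) (factorisations w))

-- Coefficients of both sides in terms of shapes.

letters : {I : Set} → Word I → DottedComposition
letters = map proj₂

-- Once an `inj₂` letter is met, no `inj₁` letter follows, so the first half is empty and the letter
-- heads the concatenation.
letters-++ : ∀ w → Increasing _<₂_ w → letters (xθ-word w) ++ letters (yφ-word w) ≡ letters w
letters-++ []                 []          = refl
letters-++ ((inj₁ i , a) ∷ w) (_ ∷ inc)   = cong (a ∷_) (letters-++ w inc)
letters-++ ((inj₂ i , a) ∷ w) (i<w ∷ inc) with xθ-word w | yφ⇒xθ-empty w i<w | letters-++ w inc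
... | .[] | refl | eq = cong (a ∷_) eq

-- By definition the coefficient of `M α` at any monomial of shape `σ`; depending on the shape
-- alone, it can be read on bare words.
δ : DottedComposition → DottedComposition → ℚ
δ σ α = if does (σ ≟ α) then 1ℚ else 0ℚ

δδ : DottedComposition → DottedComposition → DottedComposition × DottedComposition → ℚ
δδ σ τ (β , γ) = δ σ β ℚ.* δ τ γ

⊗-coefficient : ∀ β γ m → (M β ⊗ M γ) m ≡ δδ (shape (xθ-part m)) (shape (yφ-part m)) (β , γ)
-- The ordering proof `inc` is irrelevant; decidable equality on ℚ allows the equation derived from
-- it to be recomputed.
⊗-coefficient β γ (mono w inc) = recompute (_ ℚ.≟ _)
  (productCoefficient-increasing (λ u → δ (letters u) β) (λ v → δ (letters v) γ) w inc)

Δ-coefficient : ∀ α m → Δ (M α) m ≡ δ (shape (xθ-part m) ++ shape (yφ-part m)) α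
Δ-coefficient α (mono w inc) = recompute (_ ℚ.≟ _)
  (cong (λ σ → δ σ α) (trans (shape-packed 0 (letters w)) (sym (letters-++ w inc))))

-- Only the pair `(σ , τ)` contributes, and it is listed, once, exactly when `σ ++ τ` is `α`. The
-- induction strips the heads of `σ` and `α`: for empty `σ` only the first decomposition survives,
-- otherwise only the prepended ones can.
sumℚ-δδ : ∀ σ τ α → sumℚ (map (δδ σ τ) (decompositionList α)) ≡ δ (σ ++ τ) α
sumℚ-δδ []      τ []      = trans (ℚ.+-identityʳ _) (ℚ.*-identityˡ _)
sumℚ-δδ (b ∷ σ) τ []      = trans (ℚ.+-identityʳ _) (ℚ.*-zeroˡ (δ τ []))
sumℚ-δδ []      τ (a ∷ α) = begin
  1ℚ ℚ.* δ τ (a ∷ α) ℚ.+ sumℚ (map (δδ [] τ) (map (prepend a) (decompositionList α)))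
    ≡⟨ cong₂ ℚ._+_ (ℚ.*-identityˡ (δ τ (a ∷ α)))
         (sumℚ-map-zero (δδ [] τ) (prepend a) (decompositionList α) (λ (_ , γ) → ℚ.*-zeroˡ (δ τ γ))) ⟩
  δ τ (a ∷ α) ℚ.+ 0ℚ
    ≡⟨ ℚ.+-identityʳ _ ⟩
  δ τ (a ∷ α) ∎
sumℚ-δδ (b ∷ σ) τ (a ∷ α) = begin
  0ℚ ℚ.* δ τ (a ∷ α) ℚ.+ sumℚ (map (δδ (b ∷ σ) τ) (map (prepend a) (decompositionList α)))
    ≡⟨ cong₂ ℚ._+_ (ℚ.*-zeroˡ (δ τ (a ∷ α))) (cong sumℚ (sym (map-∘ (decompositionList α)))) ⟩
  0ℚ ℚ.+ sumℚ (map (δδ (b ∷ σ) τ ∘ prepend a) (decompositionList α))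
    ≡⟨ ℚ.+-identityˡ _ ⟩
  sumℚ (map (δδ (b ∷ σ) τ ∘ prepend a) (decompositionList α))
    ≡⟨ heads ⟩
  δ (b ∷ σ ++ τ) (a ∷ α) ∎
  where
  heads : sumℚ (map (δδ (b ∷ σ) τ ∘ prepend a) (decompositionList α)) ≡ δ (b ∷ σ ++ τ) (a ∷ α)
  -- Comparison of lists computes through comparison of heads, so this one Boolean decides the head
  -- test in all summands and on the right side.
  heads with does (b ≟ᴾ a)
  ... | true  = sumℚ-δδ σ τ α
  ... | false = sumℚ-zero (λ (_ , γ) → ℚ.*-zeroˡ (δ τ γ)) (decompositionList α)

-- Decompositions as cuts at a position.

cut : DottedComposition → ℕ → DottedComposition × DottedComposition
cut α k = take k α , drop k α

decompositionList-cuts : ∀ α → decompositionList α ≡ map (cut α) (upTo (suc (length α)))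
decompositionList-cuts α = trans (cuts α) (sym (map-upTo (cut α) (suc (length α))))
  where
  -- With `applyUpTo` the cut at `0` splits off by computation, and `cut (a ∷ α) (suc k)` is
  -- `prepend a (cut α k)`.
  cuts : ∀ α → decompositionList α ≡ applyUpTo (cut α) (suc (length α))
  cuts []      = refl
  cuts (a ∷ α) = cong (([] , a ∷ α) ∷_)
    (trans (cong (map (prepend a)) (cuts α)) (map-applyUpTo (cut α) (prepend a) (suc (length α))))

proposition5p7 : (α : DottedComposition) →
    (Δ (M α) ≈ ∑-over (decompositions α) (λ (β , γ) → M β ⊗ M γ))
    × (∑-over (decompositions α) (λ (β , γ) → M β ⊗ M γ) ≈ ∑ (upTo (suc (length α))) (λ k → M (take k α) ⊗ M (drop k α)))
proposition5p7 α = first , second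
  where
  summand : DottedComposition × DottedComposition → Series _<₂_
  summand (β , γ) = M β ⊗ M γ

  first : Δ (M α) ≈ ∑ (decompositionList α) summand
  first m = begin
    Δ (M α) m
      ≡⟨ Δ-coefficient α m ⟩
    δ (shape (xθ-part m) ++ shape (yφ-part m)) α
      ≡⟨ sumℚ-δδ (shape (xθ-part m)) (shape (yφ-part m)) α ⟨
    sumℚ (map (δδ (shape (xθ-part m)) (shape (yφ-part m))) (decompositionList α))
      ≡⟨ sumℚ-cong (λ (β , γ) → ⊗-coefficient β γ m) (decompositionList α) ⟨
    sumℚ (map (λ βγ → summand βγ m) (decompositionList α))
      ≡⟨ ∑-coefficient (decompositionList α) summand m ⟨
    ∑ (decompositionList α) summand m ∎

  second : ∑ (decompositionList α) summand ≈ ∑ (upTo (suc (length α))) (summand ∘ cut α)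
  -- Both sums are the same right fold, so replacing the list and fusing the `map` gives an equality
  -- of series, which is then evaluated at `m`.
  second m = cong (_$ m) (trans (cong (λ βγs → ∑ βγs summand) (decompositionList-cuts α))
                                (foldr-map (λ βγ s → summand βγ +ˢ s) (cut α) 0ˢ (upTo (suc (length α)))))
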